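{- Let $G$ be a finite simple graph with $n$ vertices whose degrees, listed in non-decreasing order, are $d_1 \le d_2 \le \dots \le d_n$. Let $\lambda \ge 0$ be the largest integer such that $$\sum_{i=1}^{\lambda} \left\lceil \frac{d_i}{2} + 1 \right\rceil \le \sum_{i=\lambda+1}^{n} \left\lfloor \frac{d_i}{2} \right\rfloor,$$ where an empty sum (e.g. $\sum_{i=1}^{0}$) equals $0$. Then $\gamma_s(G) \ge n - 2\lambda$.
   Context: For a vertex $v$ of $G$, $N[v]$ denotes the closed neighbourhood of $v$ (i.e. $v$ together with its neighbours). A signed domination function of $G$ is a function $f: V(G) \to \{ -1, 1\}$ such that $\sum_{x \in N[v]} f(x) \ge 1$ for every vertex $v \in V(G)$. The weight of $f$ is $f(V(G)) = \sum_{v \in V(G)} f(v)$. The signed domination number $\gamma_s(G)$ is the minimum weight of a signed domination function of $G$. -}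

module Defs where

open import Data.Fin.Base using (Fin)
open import Data.Fin.Properties using (_≟_; all?)
open import Data.Integer.Base as ℤ using (ℤ; 0ℤ; 1ℤ; +≤+)
import Data.Integer.Properties as ℤ
open import Data.List.Base
  using (List; []; _∷_; map; filter; foldr; length; allFin; take; drop;
         cartesianProductWith)
import Data.List.Extrema ℤ.≤-totalOrder as Extrema
open import Data.List.Membership.Propositional using (_∈_)
open import Data.List.Membership.Propositional.Properties
  using (∈-filter⁺; ∈-allFin; ∈-cartesianProductWith⁺)
open import Data.List.Properties using (map-cong)
open import Data.List.Relation.Unary.All.Properties using (all-filter)
open import Data.List.Relation.Unary.Any as Any using (here; there)
open import Data.Nat.Base as ℕ using (ℕ; zero; suc; ⌊_/2⌋; ⌈_/2⌉; z≤n; s≤s)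
import Data.Nat.Properties as ℕ
open import Data.List.Sort ℕ.≤-decTotalOrder using (sort)
open import Data.Product.Base using (∃; ∃-syntax; _×_; _,_; proj₁)
open import Data.Sign.Base using (Sign; +; -)
open import Data.Sum.Base using (inj₁; inj₂)
open import Data.Nat.ListAction using (sum)
import Data.Vec.Functional as Vector
open import Function.Base using (const)
open import Relation.Binary.Core using (Rel)
open import Relation.Binary.Definitions using (Decidable; Symmetric; Irreflexive)
open import Relation.Binary.PropositionalEquality
  using (_≡_; _≗_; refl; sym; cong; subst)
open import Relation.Nullary.Decidable using (Dec; _⊎-dec_)
open import Level using (0ℓ)

private
  variable
    n : ℕ

record SimpleGraph (n : ℕ) : Set₁ where
  field
    Adj        : Rel (Fin n) 0ℓ
    adj?       : Decidable Adj
    adj-sym    : Symmetric Adj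
    adj-irrefl : Irreflexive _≡_ Adj

open SimpleGraph public

neighbours : SimpleGraph n → Fin n → List (Fin n)
neighbours G v = filter (adj? G v) (allFin _)

degree : SimpleGraph n → Fin n → ℕ
degree G v = length (neighbours G v)

N[_] : Fin n → SimpleGraph n → List (Fin n)
N[ v ] G = filter (λ x → (x ≟ v) ⊎-dec adj? G v x) (allFin _)

-- The set {-1, 1} is represented by `Sign`, embedded in ℤ by `value`.

value : Sign → ℤ
value s = s ℤ.◃ 1

sumOver : List (Fin n) → (Fin n → Sign) → ℤ
sumOver xs f = foldr ℤ._+_ 0ℤ (map (λ x → value (f x)) xs)

weight : (Fin n → Sign) → ℤ
weight f = sumOver (allFin _) f

IsSignedDomination : SimpleGraph n → (Fin n → Sign) → Set
IsSignedDomination G f = ∀ v → sumOver (N[ v ] G) f ℤ.≥ 1ℤ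

IsSignedDominationNumber : SimpleGraph n → ℤ → Set
IsSignedDominationNumber G γ =
  (∃[ f ] IsSignedDomination G f × weight f ≡ γ) ×
  (∀ f → IsSignedDomination G f → γ ℤ.≤ weight f)

-- The minimum exists: there are finitely many functions to {-1, 1}, and the
-- constant function 1 is a signed domination function.

private
  sumOver-cong : ∀ (xs : List (Fin n)) {f g} → f ≗ g → sumOver xs f ≡ sumOver xs g
  sumOver-cong xs f≗g =
    cong (foldr ℤ._+_ 0ℤ) (map-cong (λ x → cong value (f≗g x)) xs)

  isSignedDomination? : ∀ (G : SimpleGraph n) f → Dec (IsSignedDomination G f)
  isSignedDomination? G f = all? λ v → 1ℤ ℤ.≤? sumOver (N[ v ] G) f

  signings : ∀ n → List (Fin n → Sign)
  signings zero    = (λ ()) ∷ []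
  signings (suc n) = cartesianProductWith Vector._∷_ (+ ∷ - ∷ []) (signings n)

  sign∈ : ∀ s → s ∈ (+ ∷ - ∷ [])
  sign∈ + = here refl
  sign∈ - = there (here refl)

  signings-complete : ∀ (f : Fin n → Sign) → ∃[ g ] g ∈ signings n × f ≗ g
  signings-complete {zero}  f = (λ ()) , here refl , λ ()
  signings-complete {suc n} f with signings-complete (Vector.tail f)
  ... | g , g∈ , f≗g =
    f Fin.zero Vector.∷ g ,
    ∈-cartesianProductWith⁺ Vector._∷_ (sign∈ (f Fin.zero)) g∈ ,
    λ { Fin.zero → refl ; (Fin.suc i) → f≗g i }

  sumOver-one : ∀ (xs : List (Fin n)) → sumOver xs (const +) ≡ ℤ.+ length xs
  sumOver-one []       = refl
  sumOver-one (x ∷ xs) = cong (ℤ._+_ 1ℤ) (sumOver-one xs)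

  ∈⇒1≤length : ∀ {x : Fin n} {xs} → x ∈ xs → 1 ℕ.≤ length xs
  ∈⇒1≤length (here _)  = s≤s z≤n
  ∈⇒1≤length (there _) = s≤s z≤n

  one-signedDomination : ∀ (G : SimpleGraph n) → IsSignedDomination G (const +)
  one-signedDomination G v =
    subst (1ℤ ℤ.≤_) (sym (sumOver-one (N[ v ] G)))
      (+≤+ (∈⇒1≤length
        (∈-filter⁺ (λ x → (x ≟ v) ⊎-dec adj? G v x) (∈-allFin v) (inj₁ refl))))

signedDominationNumber : (G : SimpleGraph n) → ∃ (IsSignedDominationNumber G)
signedDominationNumber {n} G =
  weight best ,
  (best , Extrema.argmin-all weight (one-signedDomination G)
            (all-filter (isSignedDomination? G) (signings n)) , refl) ,
  minimal
  where
  candidates : List (Fin n → Sign)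
  candidates = filter (isSignedDomination? G) (signings n)

  best : Fin n → Sign
  best = Extrema.argmin weight (const +) candidates

  minimal : ∀ f → IsSignedDomination G f → weight best ℤ.≤ weight f
  minimal f dom with signings-complete f
  ... | g , g∈ , f≗g =
    Extrema.f[argmin]≤v⁺ {f = weight} (const +) candidates
      (inj₂ (Any.map (λ { refl → ℤ.≤-reflexive (sym (sumOver-cong (allFin _) f≗g)) })
        (∈-filter⁺ (isSignedDomination? G) g∈
          λ v → subst (1ℤ ℤ.≤_) (sumOver-cong (N[ v ] G) f≗g) (dom v))))

γₛ : SimpleGraph n → ℤ
γₛ G = proj₁ (signedDominationNumber G)

degrees : SimpleGraph n → List ℕ
degrees G = sort (map (degree G) (allFin _))

-- `k ≤ n` is what makes both sums of the inequality meaningful.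
-- Over ℕ, ⌈ d/2 + 1 ⌉ is written as ⌈ (d + 2)/2 ⌉.

DegreeCondition : SimpleGraph n → ℕ → Set
DegreeCondition {n} G k =
  k ℕ.≤ n ×
  sum (map (λ d → ⌈ d ℕ.+ 2 /2⌉) (take k (degrees G)))
    ℕ.≤ sum (map ⌊_/2⌋ (drop k (degrees G)))

IsLargest : (ℕ → Set) → ℕ → Set
IsLargest P k = P k × (∀ m → P m → m ℕ.≤ k)

{-# OPTIONS --safe #-}
-- Let M and P be the vertices where a signed domination function f of minimum
-- weight is −1 and +1.  Since f sums to at least 1 over N[v], a vertex of P
-- has at most ⌊d/2⌋ neighbours in M, and a vertex of M has at least ⌈d/2 + 1⌉
-- neighbours in P.  Counting the edges between M and P from both sides gives
-- the inequality of the degree condition with the degrees of M on the left and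
-- those of P on the right; replacing M by the ∣M∣ smallest degrees only helps.
-- So ∣M∣ ≤ λ, and the weight of f is n − 2∣M∣.
module Submission where

open import Defs
open import Data.Nat.Base using (ℕ)
open import Data.Integer.Base using (+_; _-_; _*_; _≥_)

open import Data.Fin.Base using (Fin)
import Data.Fin.Properties as Fin
import Data.Integer.Base as ℤ
import Data.Integer.Properties as ℤ
import Data.Integer.Tactic.RingSolver as ℤ-Solver
open import Data.List.Base
  using (List; []; _∷_; _++_; map; filter; length; take; drop; allFin)
open import Data.List.Membership.Propositional using (_∈_)
open import Data.List.Membership.Propositional.Properties
  using (∈-++⁻; ∈-∃++; ∈-allFin)
open import Data.List.Properties
  using (filter-all; filter-none; filter-≐; filter-accept; filter-reject;
         filter-++; length-filter; map-++; map-∘; map-cong; length-map; length-++;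
         length-tabulate; take++drop≡id)
open import Data.List.Relation.Binary.Permutation.Propositional
  using (_↭_; prep; ↭-refl; ↭-reflexive; ↭-sym; ↭-trans)
open import Data.List.Relation.Binary.Permutation.Propositional.Properties
  using (shift; drop-∷; ++⁺ˡ; ++⁺ʳ; map⁺; filter-↭; ↭-length; ∈-resp-↭)
open import Data.List.Relation.Unary.All as All using (All; []; _∷_)
open import Data.List.Relation.Unary.All.Properties using (all-filter)
open import Data.List.Relation.Unary.AllPairs using (AllPairs; []; _∷_)
open import Data.List.Relation.Unary.Any using (here; there)
open import Data.List.Relation.Unary.Sorted.TotalOrder.Properties
  using (Sorted⇒AllPairs)
open import Data.List.Relation.Unary.Unique.Propositional using (Unique)
open import Data.List.Relation.Unary.Unique.Propositional.Properties using (allFin⁺)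
open import Data.Nat.Base as ℕ
  using (suc; _+_; _≤_; z≤n; ⌊_/2⌋; ⌈_/2⌉)
open import Data.Nat.ListAction using (sum)
open import Data.Nat.ListAction.Properties using (sum-++; sum-↭)
import Data.Nat.Properties as ℕ
open import Algebra.Properties.CommutativeSemigroup ℕ.+-commutativeSemigroup
  using (x∙yz≈y∙xz)
open import Data.List.Sort ℕ.≤-decTotalOrder using (sort-↭; sort-↗)
import Data.Nat.Tactic.RingSolver as ℕ-Solver
open import Data.Product.Base using (_,_; proj₁; proj₂)
open import Data.Sign.Base as Sign using (Sign)
open import Data.Sign.Properties using (_≟_)
open import Data.Sum.Base using (_⊎_; inj₁; inj₂)
open import Function.Base using (_∘_; flip)
open import Level using (0ℓ)
open import Relation.Binary.Core using (_Preserves_⟶_)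
import Relation.Binary.Definitions as Binary
open import Relation.Binary.PropositionalEquality
  using (_≡_; refl; sym; trans; cong; cong₂; subst; module ≡-Reasoning)
open import Relation.Nullary.Decidable using (yes; no)
open import Relation.Nullary.Negation using (¬_; contradiction)
open import Relation.Unary using (Pred; Decidable)
open import Relation.Unary.Properties using (_∪?_)

private
  variable
    A B : Set
    n : ℕ

-- Filtered lists

module _ {P Q : Pred A 0ℓ} (P? : Decidable P) (Q? : Decidable Q) where

  -- Only a permutation, since filtering by the union interleaves the two kinds of entries. It
  -- serves twice: to separate `v` from its neighbours in `N[ v ] G`, and to split a list of
  -- vertices by sign.
  filter-∪-↭ : (∀ {x} → P x → ¬ Q x) →
               ∀ xs → filter (P? ∪? Q?) xs ↭ filter P? xs ++ filter Q? xs
  filter-∪-↭ disj []       = ↭-refl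
  filter-∪-↭ disj (x ∷ xs) with P? x | Q? x | filter-∪-↭ disj xs
  ... | yes p | yes q | _  = contradiction q (disj p)
  ... | yes _ | no _  | ih = prep x ih
  ... | no _  | yes _ | ih = ↭-trans (prep x ih) (↭-sym (shift x (filter P? xs) _))
  ... | no _  | no _  | ih = ih

  filter-comm : ∀ xs → filter P? (filter Q? xs) ≡ filter Q? (filter P? xs)
  filter-comm []       = refl
  filter-comm (x ∷ xs) with P? x in eqP | Q? x in eqQ
  ... | yes _ | yes _ rewrite eqP | eqQ = cong (x ∷_) (filter-comm xs)
  ... | yes _ | no _  rewrite eqQ       = filter-comm xs
  ... | no _  | yes _ rewrite eqP       = filter-comm xs
  ... | no _  | no _                    = filter-comm xs

filter-≟-unique : ∀ {v : Fin n} {xs} → Unique xs → v ∈ xs →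
                  filter (Fin._≟ v) xs ≡ v ∷ []
filter-≟-unique {v = v} (v∉xs ∷ _) (here refl) =
  trans (filter-accept (Fin._≟ v) refl)
        (cong (v ∷_) (filter-none (Fin._≟ v) (All.map (_∘ sym) v∉xs)))
filter-≟-unique {v = v} (x∉xs ∷ xs!) (there v∈xs) =
  trans (filter-reject (Fin._≟ v) (All.lookup x∉xs v∈xs)) (filter-≟-unique xs! v∈xs)

sum-map-≤ : ∀ {f g : A → ℕ} {xs} → All (λ x → f x ≤ g x) xs →
            sum (map f xs) ≤ sum (map g xs)
sum-map-≤ []         = z≤n
sum-map-≤ (le ∷ les) = ℕ.+-mono-≤ le (sum-map-≤ les)

sum-map-++ : ∀ (f : A → ℕ) xs ys →
             sum (map f (xs ++ ys)) ≡ sum (map f xs) + sum (map f ys)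
sum-map-++ f xs ys = trans (cong sum (map-++ f xs ys)) (sum-++ (map f xs) (map f ys))

-- Double counting

module _ {R : A → B → Set} (R? : Binary.Decidable R) where

  -- Putting `x` in front raises the count of `y` by one exactly when `R x y`, and
  -- `filter (R? x) ys` collects those `y`.
  sum-filter-∷ : ∀ x xs ys →
    sum (map (λ y → length (filter (flip R? y) (x ∷ xs))) ys) ≡
    length (filter (R? x) ys) + sum (map (λ y → length (filter (flip R? y) xs)) ys)
  sum-filter-∷ x xs []       = refl
  sum-filter-∷ x xs (y ∷ ys) with R? x y | sum-filter-∷ x xs ys
  ... | yes _ | ih = cong suc (trans (cong (k ℕ.+_) ih) (x∙yz≈y∙xz k l _))
    where
    k l : ℕ
    k = length (filter (flip R? y) xs)
    l = length (filter (R? x) ys)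
  ... | no _  | ih = trans (cong (k ℕ.+_) ih) (x∙yz≈y∙xz k l _)
    where
    k l : ℕ
    k = length (filter (flip R? y) xs)
    l = length (filter (R? x) ys)

  -- Both sides count the related pairs, once row by row and once column by column.
  double-counting : ∀ xs ys →
    sum (map (λ x → length (filter (R? x) ys)) xs) ≡
    sum (map (λ y → length (filter (flip R? y) xs)) ys)
  double-counting []       []       = refl
  double-counting []       (y ∷ ys) = double-counting [] ys
  double-counting (x ∷ xs) ys =
    trans (cong (length (filter (R? x) ys) ℕ.+_) (double-counting xs ys))
          (sym (sum-filter-∷ x xs ys))

-- Prefixes and suffixes of a sorted list

module _ {g : ℕ → ℕ} (g-mono : g Preserves _≤_ ⟶ _≤_) where

  -- An exchange argument on the least entry `x`. If `x` lies in `ys`, it is removed from both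
  -- sides. If it lies in `zs`, the head `y` of `ys` is paired with it, where `g x ≤ g y`, and `y`
  -- takes the place of `x` in `zs` for the induction.
  sum-take-≤ : ∀ {xs} ys zs → AllPairs _≤_ xs → xs ↭ ys ++ zs →
               sum (map g (take (length ys) xs)) ≤ sum (map g ys)
  sum-take-≤ [] zs _ _ = z≤n
  sum-take-≤ (_ ∷ _) zs [] _ = z≤n
  sum-take-≤ {x ∷ xs} ys@(y ∷ ys′) zs (x≤xs ∷ xs↗) p
    with ∈-++⁻ ys (∈-resp-↭ p (here refl))
  ... | inj₁ x∈ys with as , bs , eq ← ∈-∃++ x∈ys = begin
    sum (map g (take (length ys) (x ∷ xs)))
      ≡⟨ cong (λ k → sum (map g (take k (x ∷ xs)))) (↭-length q) ⟩
    g x + sum (map g (take (length (as ++ bs)) xs))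
      ≤⟨ ℕ.+-monoʳ-≤ (g x)
           (sum-take-≤ (as ++ bs) zs xs↗ (drop-∷ (↭-trans p (++⁺ʳ zs q)))) ⟩
    g x + sum (map g (as ++ bs))
      ≡⟨ sum-↭ (map⁺ g q) ⟨
    sum (map g ys) ∎
    where
    open ℕ.≤-Reasoning
    q : ys ↭ x ∷ as ++ bs
    q = ↭-trans (↭-reflexive eq) (shift x as bs)
  ... | inj₂ x∈zs with as , bs , eq ← ∈-∃++ x∈zs =
    ℕ.+-mono-≤ (g-mono (All.lookup x≤xs (∈-resp-↭ (↭-sym q) (here refl))))
      (sum-take-≤ ys′ (y ∷ as ++ bs) xs↗
        (↭-trans q (↭-sym (shift y ys′ (as ++ bs)))))
    where
    q : xs ↭ ys ++ as ++ bs
    q = drop-∷ (↭-trans p (↭-trans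
          (++⁺ˡ ys (↭-trans (↭-reflexive eq) (shift x as bs)))
          (shift x ys (as ++ bs))))

  -- The two splittings of `xs` have the same total, so a smaller first part forces a larger second
  -- part.
  sum-drop-≥ : ∀ {xs} ys zs → AllPairs _≤_ xs → xs ↭ ys ++ zs →
               sum (map g zs) ≤ sum (map g (drop (length ys) xs))
  sum-drop-≥ {xs} ys zs xs↗ p = ℕ.+-cancelˡ-≤ (sum (map g ys)) _ _ (begin
    sum (map g ys) + sum (map g zs)        ≡⟨ sum-map-++ g ys zs ⟨
    sum (map g (ys ++ zs))                 ≡⟨ sum-↭ (map⁺ g p) ⟨
    sum (map g xs)                         ≡⟨ cong (sum ∘ map g) (take++drop≡id k xs) ⟨
    sum (map g (take k xs ++ drop k xs))   ≡⟨ sum-map-++ g (take k xs) (drop k xs) ⟩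
    sum (map g (take k xs)) + sum (map g (drop k xs))
      ≤⟨ ℕ.+-monoˡ-≤ _ (sum-take-≤ ys zs xs↗ p) ⟩
    sum (map g ys) + sum (map g (drop k xs)) ∎)
    where
    open ℕ.≤-Reasoning
    k = length ys

-- Rounded halves and closed neighbourhoods

2*m≤n⇒m≤⌊n/2⌋ : ∀ {m n} → m + m ≤ n → m ≤ ⌊ n /2⌋
2*m≤n⇒m≤⌊n/2⌋ {m} le =
  ℕ.≤-trans (ℕ.≤-reflexive (ℕ.n≡⌊n+n/2⌋ m)) (ℕ.⌊n/2⌋-mono le)

n≤2*m⇒⌈n/2⌉≤m : ∀ {m n} → n ≤ m + m → ⌈ n /2⌉ ≤ m
n≤2*m⇒⌈n/2⌉≤m {m} le =
  ℕ.≤-trans (ℕ.⌈n/2⌉-mono le) (ℕ.≤-reflexive (sym (ℕ.n≡⌈n+n/2⌉ m)))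

-- Irreflexivity of adjacency makes the two alternatives defining `N[ v ] G` disjoint, and
-- `allFin n` contains `v` exactly once.
N[v]↭ : ∀ (G : SimpleGraph n) v → N[ v ] G ↭ v ∷ neighbours G v
N[v]↭ {n} G v = ↭-trans
  (filter-∪-↭ (Fin._≟ v) (adj? G v) (λ x≡v v~x → adj-irrefl G (sym x≡v) v~x) (allFin n))
  (↭-reflexive (cong (_++ neighbours G v) (filter-≟-unique (allFin⁺ n) (∈-allFin v))))

-- Splitting by sign

module _ (f : Fin n → Sign) where

  minus? : Decidable (λ x → f x ≡ Sign.-)
  minus? x = f x ≟ Sign.-

  plus? : Decidable (λ x → f x ≡ Sign.+)
  plus? x = f x ≟ Sign.+

  plus-minus-disjoint : ∀ {x} → f x ≡ Sign.- → ¬ f x ≡ Sign.+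
  plus-minus-disjoint eq eq′ with () ← trans (sym eq) eq′

  filter-minus++plus : ∀ xs → xs ↭ filter minus? xs ++ filter plus? xs
  filter-minus++plus xs = ↭-trans
    -- Every sign is minus or plus, so filtering by the union of both tests removes nothing.
    (↭-reflexive (sym (filter-all (minus? ∪? plus?) (All.universal sign xs))))
    (filter-∪-↭ minus? plus? plus-minus-disjoint xs)
    where
    sign : ∀ x → f x ≡ Sign.- ⊎ f x ≡ Sign.+
    sign x with f x
    ... | Sign.- = inj₁ refl
    ... | Sign.+ = inj₂ refl

  -- Count every entry as 1; each minus sign then corrects the total by -2.
  sumOver≡ : ∀ xs → sumOver xs f ≡ + length xs - + 2 * + length (filter minus? xs)
  sumOver≡ []       = refl
  sumOver≡ (x ∷ xs) with f x | sumOver≡ xs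
  ... | Sign.+ | ih =
    trans (cong (ℤ._+_ (+ 1)) ih) (step (+ length xs) (+ length (filter minus? xs)))
    where
    step : ∀ a b → + 1 ℤ.+ (a - + 2 * b) ≡ + 1 ℤ.+ a - + 2 * b
    step = ℤ-Solver.solve-∀
  ... | Sign.- | ih =
    trans (cong (ℤ._+_ ℤ.-1ℤ) ih) (step (+ length xs) (+ length (filter minus? xs)))
    where
    step : ∀ a b → ℤ.-1ℤ ℤ.+ (a - + 2 * b) ≡ + 1 ℤ.+ a - + 2 * (+ 1 ℤ.+ b)
    step = ℤ-Solver.solve-∀

-- Degree bounds and the edge count for a signed domination function

module _ (G : SimpleGraph n) (f : Fin n → Sign) (dom : IsSignedDomination G f) where

  M P : List (Fin n)
  M = filter (minus? f) (allFin n)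
  P = filter (plus? f) (allFin n)

  M-nbrs P-nbrs : Fin n → ℕ
  M-nbrs v = length (filter (adj? G v) M)
  P-nbrs v = length (filter (adj? G v) P)

  minus-neighbours : ∀ v → length (filter (minus? f) (neighbours G v)) ≡ M-nbrs v
  minus-neighbours v = cong length (filter-comm (minus? f) (adj? G v) (allFin n))

  degree≡ : ∀ v → degree G v ≡ M-nbrs v + P-nbrs v
  degree≡ v = begin
    degree G v
      ≡⟨ ↭-length (filter-↭ (adj? G v) (filter-minus++plus f (allFin n))) ⟩
    length (filter (adj? G v) (M ++ P))
      ≡⟨ cong length (filter-++ (adj? G v) M P) ⟩
    length (filter (adj? G v) M ++ filter (adj? G v) P)
      ≡⟨ length-++ (filter (adj? G v) M) ⟩
    M-nbrs v + P-nbrs v ∎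
    where open ≡-Reasoning

  -- Since `N[ v ] G` has `suc (degree G v)` entries, domination at `v` reads 1 ≤ 1 + deg - 2k, and
  -- the two ones cancel. With `v` written in front, the sign of `v` alone decides whether `k` is
  -- `M-nbrs v` or one more.
  minus-closed-≤ : ∀ v → let k = length (filter (minus? f) (v ∷ neighbours G v)) in
                   k + k ≤ degree G v
  minus-closed-≤ v = ℕ.s≤s⁻¹ (ℤ.drop‿+≤+ (begin
    + 1 ℤ.+ + (k + k)
      ≤⟨ ℤ.+-monoˡ-≤ (+ (k + k)) (dom v) ⟩
    sumOver (N[ v ] G) f ℤ.+ + (k + k)
      ≡⟨ cong (ℤ._+ + (k + k)) (sumOver≡ f (N[ v ] G)) ⟩
    + length (N[ v ] G) - + 2 * + length (filter (minus? f) (N[ v ] G)) ℤ.+ + (k + k)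
      ≡⟨ cong₂ (λ a b → + a - + 2 * + b ℤ.+ + (k + k))
           (↭-length (N[v]↭ G v)) (↭-length (filter-↭ (minus? f) (N[v]↭ G v))) ⟩
    + suc (degree G v) - + 2 * + k ℤ.+ (+ k ℤ.+ + k)
      ≡⟨ cancel (+ suc (degree G v)) (+ k) ⟩
    + suc (degree G v) ∎))
    where
    open ℤ.≤-Reasoning
    k = length (filter (minus? f) (v ∷ neighbours G v))
    cancel : ∀ a b → a - + 2 * b ℤ.+ (b ℤ.+ b) ≡ a
    cancel = ℤ-Solver.solve-∀

  -- Here `v` itself is not counted among the minus vertices of its closed neighbourhood, so `k` is
  -- `M-nbrs v`.
  plus-bound : ∀ {v} → f v ≡ Sign.+ → M-nbrs v ≤ ⌊ degree G v /2⌋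
  plus-bound {v} fv≡+ = 2*m≤n⇒m≤⌊n/2⌋
    (subst (λ k → k + k ≤ degree G v) eq (minus-closed-≤ v))
    where
    eq : length (filter (minus? f) (v ∷ neighbours G v)) ≡ M-nbrs v
    eq = trans
      (cong length (filter-reject (minus? f) (λ eq → plus-minus-disjoint f eq fv≡+)))
      (minus-neighbours v)

  -- Here `v` counts itself, so with a and b neighbours in `M` and `P` the closed bound is 2(1 + a)
  -- ≤ a + b. Hence 2 + a ≤ b, and deg + 2 = a + b + 2 ≤ 2b.
  minus-bound : ∀ {v} → f v ≡ Sign.- → ⌈ degree G v + 2 /2⌉ ≤ P-nbrs v
  minus-bound {v} fv≡- = n≤2*m⇒⌈n/2⌉≤m (begin
    degree G v + 2  ≡⟨ cong (_+ 2) (degree≡ v) ⟩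
    a + b + 2       ≡⟨ rearrange a b ⟩
    2 + a + b       ≤⟨ ℕ.+-monoˡ-≤ b 2+a≤b ⟩
    b + b           ∎)
    where
    open ℕ.≤-Reasoning
    a b : ℕ
    a = M-nbrs v
    b = P-nbrs v
    rearrange : ∀ a b → a + b + 2 ≡ 2 + a + b
    rearrange = ℕ-Solver.solve-∀
    double : ∀ a → suc a + suc a ≡ a + (2 + a)
    double = ℕ-Solver.solve-∀
    eq : length (filter (minus? f) (v ∷ neighbours G v)) ≡ suc a
    eq = trans (cong length (filter-accept (minus? f) fv≡-))
               (cong suc (minus-neighbours v))
    2+a≤b : 2 + a ≤ b
    2+a≤b = ℕ.+-cancelˡ-≤ a _ _ (begin
      a + (2 + a)    ≡⟨ double a ⟨
      suc a + suc a  ≡⟨ cong (λ k → k + k) eq ⟨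
      _              ≤⟨ minus-closed-≤ v ⟩
      degree G v     ≡⟨ degree≡ v ⟩
      a + b          ∎)

  edge-count : sum (map P-nbrs M) ≡ sum (map M-nbrs P)
  edge-count = trans (double-counting (adj? G) M P)
    -- Double counting yields the adjacency with its arguments swapped; symmetry of the graph turns
    -- it back.
    (cong sum (map-cong (λ w → cong length
      (filter-≐ (flip (adj? G) w) (adj? G w) (adj-sym G , adj-sym G) M)) P))

  degrees-↭ : degrees G ↭ map (degree G) M ++ map (degree G) P
  degrees-↭ = ↭-trans (sort-↭ _) (↭-trans
    (map⁺ (degree G) (filter-minus++plus f (allFin n)))
    (↭-reflexive (map-++ (degree G) M P)))

  degrees-↗ : AllPairs _≤_ (degrees G)
  degrees-↗ = Sorted⇒AllPairs ℕ.≤-totalOrder (sort-↗ _)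

  degreeCondition : DegreeCondition G (length M)
  degreeCondition =
    ℕ.≤-trans (length-filter (minus? f) (allFin n))
              (ℕ.≤-reflexive (length-tabulate {n = n} (λ i → i))) ,
    -- The sorted-list lemmas cut at the length of the list of degrees of `M`, which equals the
    -- length of `M`.
    subst (λ k → sum (map up (take k (degrees G))) ≤ sum (map ⌊_/2⌋ (drop k (degrees G))))
      (length-map (degree G) M) (begin
    sum (map up (take k (degrees G)))
      ≤⟨ sum-take-≤ (ℕ.⌈n/2⌉-mono ∘ ℕ.+-monoˡ-≤ 2)
           (map (degree G) M) _ degrees-↗ degrees-↭ ⟩
    sum (map up (map (degree G) M))
      ≡⟨ cong sum (map-∘ M) ⟨
    sum (map (up ∘ degree G) M)
      ≤⟨ sum-map-≤ (All.map minus-bound (all-filter (minus? f) (allFin n))) ⟩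
    sum (map P-nbrs M)
      ≡⟨ edge-count ⟩
    sum (map M-nbrs P)
      ≤⟨ sum-map-≤ (All.map plus-bound (all-filter (plus? f) (allFin n))) ⟩
    sum (map (⌊_/2⌋ ∘ degree G) P)
      ≡⟨ cong sum (map-∘ P) ⟩
    sum (map ⌊_/2⌋ (map (degree G) P))
      ≤⟨ sum-drop-≥ ℕ.⌊n/2⌋-mono (map (degree G) M) _ degrees-↗ degrees-↭ ⟩
    sum (map ⌊_/2⌋ (drop k (degrees G))) ∎)
    where
    open ℕ.≤-Reasoning
    k : ℕ
    k = length (map (degree G) M)
    up : ℕ → ℕ
    up d = ⌈ d + 2 /2⌉

  weight≡ : weight f ≡ + n - + 2 * + length M
  weight≡ = trans (sumOver≡ f (allFin n))
    (cong (λ k → + k - + 2 * + length M) (length-tabulate {n = n} (λ i → i)))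

theorem6 : ∀ (n : ℕ) (G : SimpleGraph n) (l : ℕ) →
    IsLargest (DegreeCondition G) l →
    γₛ G ≥ + n - + 2 * + l
theorem6 n G l (_ , largest)
  -- The minimum is attained, so some signed domination function `f` has weight `γₛ G`.
  with f , dom , weight≡γ ← proj₁ (proj₂ (signedDominationNumber G)) = begin
  + n - + 2 * + l
    -- Maximality of `l` gives ∣M∣ ≤ `l`; multiplying by -2 reverses the inequality.
    ≤⟨ ℤ.+-monoʳ-≤ (+ n) (ℤ.neg-mono-≤ (ℤ.*-monoˡ-≤-nonNeg (+ 2)
         (ℤ.+≤+ (largest _ (degreeCondition G f dom))))) ⟩
  + n - + 2 * + length (M G f dom)
    ≡⟨ weight≡ G f dom ⟨
  weight f
    ≡⟨ weight≡γ ⟩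
  γₛ G ∎
  where open ℤ.≤-Reasoning
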